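{- Let $n\ge 3$ and $x\in S_n$ avoid $132$. Then there exists $1\le i\le n-2$ with $|\mathrm{Act}_i(x;132)|=|\mathrm{Act}_{i+1}(x;132)|\le|\mathrm{Act}_{i+2}(x;132)|$ if and only if $x$ contains the bivincular pattern $123^{\star}$.
   Context: For $w=w_1\cdots w_{m}\in S_{m}$ and $1\le i\le m+1$, let $w^i$ be the permutation obtained by inserting $m+1$ immediately before $w_i$ (at the end if $i=m+1$). For a pattern $y$, site $i$ of $w$ is active with respect to $y$ if $w^i$ avoids $y$ (has no subsequence order-isomorphic to $y$). For $x\in S_n$ and $1\le k\le n$, let $\mathrm{small}_k(x)$ be the subsequence of $x$ formed by the entries $1,\dots,k$ (a permutation in $S_k$). For $1\le j\le n$, $\mathrm{Act}_j(x;y)$ is the set of active sites of $\mathrm{small}_{n+1-j}(x)$ with respect to $y$. An occurrence of the bivincular pattern $123^{\star}$ in $x$ is a pair of indices $a<b<n$ with $x_a<x_b$ and $x_{b+1}=x_b+1$. -}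

module Defs where

open import Data.Fin.Base as Fin using (Fin; toℕ; cast)
open import Data.Fin.Properties using (all?)
open import Data.Fin.Subset using (Subset)
open import Data.List.Base using (List; []; _∷_; length; lookup; map; upTo; filter; insertAt)
open import Data.List.Relation.Binary.Permutation.Propositional using (_↭_)
open import Data.List.Relation.Binary.Sublist.Propositional using (_⊆_; []; _∷_; _∷ʳ_)
open import Data.Nat.Base using (ℕ; suc; _∸_; _<_)
open import Data.Nat.Properties using (_≟_; _<?_; _≤?_)
open import Data.Product.Base using (∃-syntax; _×_; _,_; proj₁; proj₂)
open import Data.Sum.Base using (inj₁; inj₂)
open import Data.Vec.Base using (tabulate)
open import Function.Base using (_∘_)
open import Function.Bundles using (_⇔_; mk⇔; Equivalence)
open import Level using (Level)
open import Relation.Binary.PropositionalEquality using (_≡_; refl)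
open import Relation.Nullary using (¬_; Dec; yes; no; does)
open import Relation.Nullary.Decidable using (map′; ¬?; _×-dec_; _⊎-dec_; _→-dec_)
open import Relation.Unary using (Pred; Decidable)

-- One-line notation: the word w₁ ⋯ wₙ, with entries 1, …, n.
Word : Set
Word = List ℕ

IsPermutation : ℕ → Word → Set
IsPermutation n w = w ↭ map suc (upTo n)

OrderIsomorphic : Word → Word → Set
OrderIsomorphic u v = ∃[ eq ] ∀ (i j : Fin (length u)) →
  lookup u i < lookup u j ⇔ lookup v (cast {n = length v} eq i) < lookup v (cast eq j)

Contains : Word → Word → Set
Contains w y = ∃[ u ] (u ⊆ w × OrderIsomorphic u y)

Avoids : Word → Word → Set
Avoids w y = ¬ Contains w y

orderIsomorphic? : ∀ u v → Dec (OrderIsomorphic u v)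
orderIsomorphic? u v with length u ≟ length v
... | no neq = no (neq ∘ proj₁)
... | yes eq = map′ (eq ,_) proj₂ (all? λ i → all? λ j →
  iff? (lookup u i <? lookup u j) (lookup v (cast eq i) <? lookup v (cast eq j)))
  where
  iff? : {A B : Set} → Dec A → Dec B → Dec (A ⇔ B)
  iff? a? b? = map′ (λ (f , g) → mk⇔ f g) (λ e → Equivalence.to e , Equivalence.from e)
    ((a? →-dec b?) ×-dec (b? →-dec a?))

anySublist? : ∀ {P : Pred Word Level.zero} → Decidable P → ∀ w → Dec (∃[ u ] (u ⊆ w × P u))
anySublist? P? [] = map′ (λ p → [] , [] , p) (λ { (_ , [] , p) → p }) (P? [])
anySublist? P? (a ∷ w) = map′
  (λ { (inj₁ (u , s , p)) → u , a ∷ʳ s , p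
     ; (inj₂ (u , s , p)) → a ∷ u , refl ∷ s , p })
  (λ { (u , _ ∷ʳ s , p) → inj₁ (u , s , p)
     ; (_ , refl ∷ s , p) → inj₂ (_ , s , p) })
  (anySublist? P? w ⊎-dec anySublist? (P? ∘ (a ∷_)) w)

avoids? : ∀ w y → Dec (Avoids w y)
avoids? w y = ¬? (anySublist? (λ u → orderIsomorphic? u y) w)

-- Sites are numbered from zero: site i of the text is the element i - 1 of Fin (m + 1).
Site : Word → Set
Site w = Fin (suc (length w))

insertMax : (w : Word) → Site w → Word
insertMax w i = insertAt w i (suc (length w))

Active : (w y : Word) → Site w → Set
Active w y i = Avoids (insertMax w i) y

active? : (w y : Word) → Decidable (Active w y)
active? w y i = avoids? (insertMax w i) y

activeSites : (w y : Word) → Subset (suc (length w))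
activeSites w y = tabulate (λ i → does (active? w y i))

small : ℕ → Word → Word
small k = filter (_≤? k)

-- Meaningful for 1 ≤ j ≤ n, where n = length x.
Act : (j : ℕ) (x y : Word) → Subset (suc (length (small (suc (length x) ∸ j) x)))
Act j x y = activeSites (small (suc (length x) ∸ j) x) y

-- The index c plays the role of b + 1, so its existence encodes b < n.
Contains123⋆ : Word → Set
Contains123⋆ x = ∃[ a ] ∃[ b ] ∃[ c ]
  (a Fin.< b × toℕ c ≡ suc (toℕ b) × lookup x a < lookup x b × lookup x c ≡ suc (lookup x b))

pattern132 : Word
pattern132 = 1 ∷ 3 ∷ 2 ∷ []

{-# OPTIONS --safe #-}
module Submission where

-- Inserting a new maximum into a 132-avoider keeps it 132-avoiding exactly at the cuts: the sites
-- with every entry on the left at least every entry on the right. If small_k(x) = p k q, then the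
-- cuts of small_k(x) are the leftmost site and the cuts of p q from the end of p onwards. Hence
-- |Act| is unchanged on passing from k - 1 to k iff p is nonempty and the leftmost site is the only
-- cut of p q before the end of p, and it does not grow on passing from k - 2 to k - 1 iff k - 1 is
-- not the first entry of p q. As the site right after the maximum k - 1 is a cut, both hold iff p
-- ends in k - 1 and has a further entry. Finally k - 1 and k are adjacent in x iff they are
-- adjacent in small_k(x), because a larger z between them would give the occurrence k - 1, z, k of 132.

open import Data.Bool.Base using (Bool; true; false; if_then_else_)
open import Data.Empty using (⊥-elim)
open import Data.Fin.Base as Fin using (Fin; toℕ; zero; suc)
open import Data.Fin.Subset using (∣_∣)
open import Data.List.Base using (List; []; _∷_; _++_; _∷ʳ_; [_]; length; lookup; map; upTo; filter; insertAt; take; drop)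
open import Data.List.Membership.Propositional using (_∈_)
open import Data.List.Membership.Propositional.Properties using (∈-∃++; ∈-++⁺ˡ; ∈-++⁺ʳ; ∈-++⁻; ∈-filter⁺; ∈-filter⁻; ∈-map⁺; ∈-map⁻; ∈-upTo⁺; ∈-insert)
open import Data.List.Properties using (∷-injective; ++-assoc; ++-identityʳ; ∷ʳ-++; filter-++; filter-all; filter-accept; filter-reject; map-++; upTo-∷ʳ; length-map; length-upTo; take++drop≡id)
open import Data.List.Relation.Binary.Permutation.Propositional using (_↭_; ↭-sym; ↭-trans; ↭-reflexive)
open import Data.List.Relation.Binary.Permutation.Propositional.Properties using (All-resp-↭; ∈-resp-↭; ↭-length; filter-↭; drop-mid)
open import Data.List.Relation.Binary.Sublist.Propositional using (_⊆_; []; _∷_; minimum; ⊆-trans; ⊆-refl; from∈; to∈) renaming (_∷ʳ_ to _skip_)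
open import Data.List.Relation.Binary.Sublist.Propositional.Properties using (++⁺; ++⁺ˡ; filter-⊆)
open import Data.List.Relation.Unary.All as All using (All; []; _∷_)
open import Data.List.Relation.Unary.All.Properties as All using (all-upTo)
open import Data.List.Relation.Unary.Any using (here; there)
open import Data.Nat.Base using (ℕ; zero; suc; _+_; _∸_; _≤_; _<_; z≤n; s≤s; s<s; z<s)
open import Data.Nat.Properties
open import Data.Product.Base using (∃-syntax; _×_; _,_; proj₁; proj₂)
open import Data.Sum.Base using (_⊎_; inj₁; inj₂)
open import Data.Vec.Base using (tabulate)
open import Function.Base using (_∘_; case_of_)
open import Function.Bundles using (_⇔_; mk⇔; Equivalence)
open import Level using (0ℓ)
open import Relation.Binary.PropositionalEquality using (_≡_; refl; sym; trans; cong; cong₂; subst; module ≡-Reasoning)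
open import Relation.Nullary using (¬_; Dec; yes; no; does; contradiction)
open import Relation.Nullary.Decidable using (dec-true; dec-false; does-⇔)
open import Relation.Unary using (Pred; Decidable)
open import Defs

-- Occurrences of 132 as sublists.

avoids-132 : ∀ {w a b c} → Avoids w pattern132 → a ∷ c ∷ b ∷ [] ⊆ w → a < b → ¬ b < c
avoids-132 {w} {a} {b} {c} av s a<b b<c = av (a ∷ c ∷ b ∷ [] , s , refl , iso)
  where
  v : List ℕ
  v = a ∷ c ∷ b ∷ []
  a<c : a < c
  a<c = <-trans a<b b<c
  both : ∀ {A B : Set} → A → B → A ⇔ B
  both x y = mk⇔ (λ _ → y) (λ _ → x)
  neither : ∀ {A B : Set} → ¬ A → ¬ B → A ⇔ B
  neither x y = mk⇔ (⊥-elim ∘ x) (⊥-elim ∘ y)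
  iso : ∀ (i j : Fin 3) → lookup v i < lookup v j ⇔ lookup pattern132 (Fin.cast refl i) < lookup pattern132 (Fin.cast refl j)
  iso zero             zero             = neither (<-irrefl refl) (<-irrefl refl)
  iso zero             (suc zero)       = both a<c (s<s z<s)
  iso zero             (suc (suc zero)) = both a<b (s<s z<s)
  iso (suc zero)       zero             = neither (<-asym a<c) (<-asym (s<s z<s))
  iso (suc zero)       (suc zero)       = neither (<-irrefl refl) (<-irrefl refl)
  iso (suc zero)       (suc (suc zero)) = neither (<-asym b<c) (<-asym (s<s (s<s z<s)))
  iso (suc (suc zero)) zero             = neither (<-asym a<b) (<-asym (s<s z<s))
  iso (suc (suc zero)) (suc zero)       = both b<c (s<s (s<s z<s))
  iso (suc (suc zero)) (suc (suc zero)) = neither (<-irrefl refl) (<-irrefl refl)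

contains-132 : ∀ {w} → Contains w pattern132 →
  ∃[ a ] ∃[ b ] ∃[ c ] (a ∷ c ∷ b ∷ [] ⊆ w × a < b × b < c)
contains-132 ([] , _ , () , _)
contains-132 (_ ∷ [] , _ , () , _)
contains-132 (_ ∷ _ ∷ [] , _ , () , _)
contains-132 (a ∷ c ∷ b ∷ [] , s , eq , iso) = a , b , c , s ,
  Equivalence.from (iso zero (suc (suc zero))) (s<s z<s) ,
  Equivalence.from (iso (suc (suc zero)) (suc zero)) (s<s (s<s z<s))
contains-132 (_ ∷ _ ∷ _ ∷ _ ∷ _ , _ , () , _)

avoids-⊆ : ∀ {v w y} → v ⊆ w → Avoids w y → Avoids v y
avoids-⊆ s av (u , t , iso) = av (u , ⊆-trans t s , iso)

-- Locates the inserted entry in an occurrence: either the occurrence misses it and lived in the old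
-- word, or it splits around it.
⊆-insert⁻ : ∀ {t m} u {v : Word} → t ⊆ u ++ m ∷ v →
  t ⊆ u ++ v ⊎ ∃[ t₁ ] ∃[ t₂ ] (t ≡ t₁ ++ m ∷ t₂ × t₁ ⊆ u × t₂ ⊆ v)
⊆-insert⁻ [] (_ skip s) = inj₁ s
⊆-insert⁻ [] (refl ∷ s) = inj₂ ([] , _ , refl , [] , s)
⊆-insert⁻ (a ∷ u) (_ skip s) with ⊆-insert⁻ u s
... | inj₁ s′ = inj₁ (a skip s′)
... | inj₂ (t₁ , t₂ , eq , s₁ , s₂) = inj₂ (t₁ , t₂ , eq , a skip s₁ , s₂)
⊆-insert⁻ (a ∷ u) (refl ∷ s) with ⊆-insert⁻ u s
... | inj₁ s′ = inj₁ (refl ∷ s′)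
... | inj₂ (t₁ , t₂ , eq , s₁ , s₂) = inj₂ (a ∷ t₁ , t₂ , cong (a ∷_) eq , refl ∷ s₁ , s₂)

-- Cuts: which sites are active, and how many there are.

-- The weak inequality is the exact negation of an ascent `a < b` across the site; such an ascent
-- becomes 132 once a larger entry is put at the site.
Cut : Word → Word → Set
Cut u v = All (λ a → All (_≤ a) v) u

cut? : ∀ u v → Dec (Cut u v)
cut? u v = All.all? (λ a → All.all? (_≤? a) v) u

¬cut : ∀ {u v a b} → a ∈ u → b ∈ v → a < b → ¬ Cut u v
¬cut a∈u b∈v a<b c = <⇒≱ a<b (All.lookup (All.lookup c a∈u) b∈v)

-- An ascent across the site forms 132 with `m` between its ends. Conversely a new occurrence must
-- use `m`, which as strict maximum can only be the `3`, so its other two entries are an ascent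
-- across the site.
insertMax-avoids⇔cut : ∀ {m} u {v} → Avoids (u ++ v) pattern132 → All (_< m) (u ++ v) →
  Avoids (u ++ m ∷ v) pattern132 ⇔ Cut u v
insertMax-avoids⇔cut {m} u {v} av bound = mk⇔ to from
  where
  to : Avoids (u ++ m ∷ v) pattern132 → Cut u v
  to av′ = All.tabulate λ a∈u → All.tabulate λ b∈v → ≮⇒≥ λ a<b →
    avoids-132 av′ (++⁺ (from∈ a∈u) (refl ∷ from∈ b∈v)) a<b (All.lookup bound (∈-++⁺ʳ u b∈v))
  from : Cut u v → Avoids (u ++ m ∷ v) pattern132
  from cut con with contains-132 con
  ... | a , b , c , s , a<b , b<c with ⊆-insert⁻ u s
  ... | inj₁ s′ = avoids-132 av s′ a<b b<c
  -- The number of entries before `m` decides its role: none makes it the `1`, one the `3`, two the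
  -- `2`. The first and last contradict maximality.
  ... | inj₂ ([] , _ , refl , _ , s₂) =
    <-asym a<b (All.lookup bound (∈-++⁺ʳ u (to∈ (⊆-trans (c skip ⊆-refl) s₂))))
  ... | inj₂ (_ ∷ [] , _ , refl , s₁ , s₂) = ¬cut (to∈ s₁) (to∈ s₂) a<b cut
  ... | inj₂ (_ ∷ _ ∷ [] , _ , refl , s₁ , _) =
    <-asym b<c (All.lookup bound (∈-++⁺ˡ (to∈ (⊆-trans (a skip ⊆-refl) s₁))))
  ... | inj₂ (_ ∷ _ ∷ _ ∷ [] , _ , () , _)
  ... | inj₂ (_ ∷ _ ∷ _ ∷ _ ∷ _ , _ , () , _)

-- The number of cuts of u ++ v at the sites from the end of u onwards.
cuts : Word → Word → ℕ
cuts u [] = 1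
cuts u (b ∷ v) = (if does (cut? u (b ∷ v)) then 1 else 0) + cuts (u ∷ʳ b) v

cuts-yes : ∀ {u b v} → Cut u (b ∷ v) → cuts u (b ∷ v) ≡ suc (cuts (u ∷ʳ b) v)
cuts-yes {u} {b} {v} c rewrite dec-true (cut? u (b ∷ v)) c = refl

cuts-no : ∀ {u b v} → ¬ Cut u (b ∷ v) → cuts u (b ∷ v) ≡ cuts (u ∷ʳ b) v
cuts-no {u} {b} {v} c rewrite dec-false (cut? u (b ∷ v)) c = refl

-- Both sides count cuts of the same word, but the left one starts later and so misses the sites
-- before the end of `v`.
cuts-++-≤ : ∀ u v q → cuts (u ++ v) q ≤ cuts u (v ++ q)
cuts-++-≤ u [] q = ≤-reflexive (cong (λ z → cuts z q) (++-identityʳ u))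
cuts-++-≤ u (b ∷ v) q = begin
  cuts (u ++ b ∷ v) q          ≡⟨ cong (λ z → cuts z q) (∷ʳ-++ u b v) ⟨
  cuts ((u ∷ʳ b) ++ v) q       ≤⟨ cuts-++-≤ (u ∷ʳ b) v q ⟩
  cuts (u ∷ʳ b) (v ++ q)       ≤⟨ m≤n+m _ _ ⟩
  cuts u (b ∷ v ++ q)          ∎
  where open ≤-Reasoning

-- Every site from the end of `u` up to just before `m` has `a` on its left and `m` on its right,
-- hence is no cut.
cuts-skip : ∀ {a m} u p q → a ∈ u → a < m → cuts u (p ++ m ∷ q) ≡ cuts (u ++ p ∷ʳ m) q
cuts-skip u [] q a∈u a<m = cuts-no (¬cut a∈u (here refl) a<m)
cuts-skip {a} {m} u (b ∷ p) q a∈u a<m = begin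
  cuts u (b ∷ p ++ m ∷ q)      ≡⟨ cuts-no (¬cut a∈u (there (∈-insert p)) a<m) ⟩
  cuts (u ∷ʳ b) (p ++ m ∷ q)   ≡⟨ cuts-skip (u ∷ʳ b) p q (∈-++⁺ˡ a∈u) a<m ⟩
  cuts ((u ∷ʳ b) ++ p ∷ʳ m) q  ≡⟨ cong (λ z → cuts z q) (∷ʳ-++ u b (p ∷ʳ m)) ⟩
  cuts (u ++ b ∷ p ∷ʳ m) q     ∎
  where open ≡-Reasoning

-- At every counted site `m` stands on the left and dominates all of the right, so it imposes no
-- condition. The word `u` collects the entries of `q` already passed.
cuts-drop-max : ∀ {m} p u q → All (_≤ m) q → cuts (p ++ m ∷ u) q ≡ cuts (p ++ u) q
cuts-drop-max p u [] [] = refl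
cuts-drop-max {m} p u (b ∷ q) bound@(_ ∷ bound′) = cong₂ _+_
  (cong (if_then 1 else 0) (does-⇔ (mk⇔ to from) (cut? (p ++ m ∷ u) (b ∷ q)) (cut? (p ++ u) (b ∷ q))))
  (begin
    cuts ((p ++ m ∷ u) ∷ʳ b) q   ≡⟨ cong (λ z → cuts z q) (++-assoc p (m ∷ u) [ b ]) ⟩
    cuts (p ++ m ∷ (u ∷ʳ b)) q   ≡⟨ cuts-drop-max p (u ∷ʳ b) q bound′ ⟩
    cuts (p ++ (u ∷ʳ b)) q       ≡⟨ cong (λ z → cuts z q) (++-assoc p u [ b ]) ⟨
    cuts ((p ++ u) ∷ʳ b) q       ∎)
  where
  open ≡-Reasoning
  to : Cut (p ++ m ∷ u) (b ∷ q) → Cut (p ++ u) (b ∷ q)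
  to c = All.++⁺ (All.++⁻ˡ p c) (All.tail (All.++⁻ʳ p c))
  from : Cut (p ++ u) (b ∷ q) → Cut (p ++ m ∷ u) (b ∷ q)
  from c = All.++⁺ (All.++⁻ˡ p c) (bound ∷ All.++⁻ʳ p c)

-- Before the maximum the only cut is the leftmost site, and after it the cuts are unaffected.
cuts-insert-max : ∀ {m} p q → All (_< m) p → All (_≤ m) q →
  cuts [] (p ++ m ∷ q) ≡ suc (cuts p q)
cuts-insert-max [] q _ bound = cong suc (cuts-drop-max [] [] q bound)
cuts-insert-max {m} (b ∷ p) q (b<m ∷ _) bound = cong suc (begin
  cuts [ b ] (p ++ m ∷ q)        ≡⟨ cuts-skip [ b ] p q (here refl) b<m ⟩
  cuts (b ∷ p ++ m ∷ []) q       ≡⟨ cuts-drop-max (b ∷ p) [] q bound ⟩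
  cuts (b ∷ p ++ []) q           ≡⟨ cong (λ z → cuts z q) (++-identityʳ (b ∷ p)) ⟩
  cuts (b ∷ p) q                 ∎)
  where open ≡-Reasoning

-- The prefix `u` matches the accumulator of `cuts`, so that the induction can move the head of `v`
-- into it.
∣tabulate∣≡cuts : ∀ u v (f : Fin (suc (length v)) → Bool) →
  (∀ i → f i ≡ does (cut? (u ++ take (toℕ i) v) (drop (toℕ i) v))) → ∣ tabulate f ∣ ≡ cuts u v
∣tabulate∣≡cuts u [] f hyp
  rewrite hyp zero | dec-true (cut? (u ++ []) []) (All.tabulate (λ _ → [])) = refl
∣tabulate∣≡cuts u (b ∷ v) f hyp
  with f zero | trans (hyp zero) (cong (λ z → does (cut? z (b ∷ v))) (++-identityʳ u))
     | ∣tabulate∣≡cuts (u ∷ʳ b) v (f ∘ suc) (λ i → trans (hyp (suc i))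
         (cong (λ z → does (cut? z (drop (toℕ i) v))) (sym (∷ʳ-++ u b (take (toℕ i) v)))))
... | true  | eq | ih rewrite sym eq = cong suc ih
... | false | eq | ih rewrite sym eq = ih

insertAt≡take++∷drop : ∀ (w : Word) i m → insertAt w i m ≡ take (toℕ i) w ++ m ∷ drop (toℕ i) w
insertAt≡take++∷drop w       zero    m = refl
insertAt≡take++∷drop (a ∷ w) (suc i) m = cong (a ∷_) (insertAt≡take++∷drop w i m)

∣activeSites∣≡cuts : ∀ w → Avoids w pattern132 → All (_≤ length w) w →
  ∣ activeSites w pattern132 ∣ ≡ cuts [] w
∣activeSites∣≡cuts w av bound = ∣tabulate∣≡cuts [] w _ λ i →
  does-⇔ (active⇔cut i) (active? w pattern132 i) (cut? (take (toℕ i) w) (drop (toℕ i) w))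
  where
  active⇔cut : ∀ i → Active w pattern132 i ⇔ Cut (take (toℕ i) w) (drop (toℕ i) w)
  active⇔cut i rewrite insertAt≡take++∷drop w i (suc (length w)) =
    insertMax-avoids⇔cut (take (toℕ i) w)
      (subst (λ z → Avoids z pattern132) (sym (take++drop≡id (toℕ i) w)) av)
      (subst (All (_< suc (length w))) (sym (take++drop≡id (toℕ i) w)) (All.map s≤s bound))

-- Permutations and their restrictions to small entries.

identity-∷ʳ : ∀ k → map suc (upTo (suc k)) ≡ map suc (upTo k) ∷ʳ suc k
identity-∷ʳ k = trans (cong (map suc) (sym (upTo-∷ʳ k))) (map-++ suc (upTo k) [ k ])

identity-≤ : ∀ k → All (_≤ k) (map suc (upTo k))
identity-≤ k = All.map⁺ (all-upTo k)

perm-≤ : ∀ {k w} → IsPermutation k w → All (_≤ k) w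
perm-≤ {k} π = All-resp-↭ (↭-sym π) (identity-≤ k)

perm-length : ∀ {k w} → IsPermutation k w → length w ≡ k
perm-length {k} π = trans (↭-length π) (trans (length-map suc (upTo k)) (length-upTo k))

perm-positive : ∀ {k w a} → IsPermutation k w → a ∈ w → 0 < a
perm-positive π a∈w with ∈-map⁻ suc (∈-resp-↭ π a∈w)
... | _ , _ , refl = z<s

perm-max∈ : ∀ {k w} → IsPermutation (suc k) w → suc k ∈ w
perm-max∈ {k} π = ∈-resp-↭ (↭-sym π) (∈-map⁺ suc (∈-upTo⁺ (n<1+n k)))

perm-drop-max : ∀ {k} p q → IsPermutation (suc k) (p ++ suc k ∷ q) → IsPermutation k (p ++ q)
perm-drop-max {k} p q π = subst (p ++ q ↭_) (++-identityʳ (map suc (upTo k)))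
  (drop-mid p (map suc (upTo k)) (subst (p ++ suc k ∷ q ↭_) (identity-∷ʳ k) π))

small-++ : ∀ k u v → small k (u ++ v) ≡ small k u ++ small k v
small-++ k = filter-++ (_≤? k)

small-identity : ∀ {k n} → k ≤ n → small k (map suc (upTo n)) ≡ map suc (upTo k)
small-identity {k} {n} k≤n with m≤n⇒m<n∨m≡n k≤n
... | inj₂ refl = filter-all (_≤? k) (identity-≤ k)
small-identity {k} {suc n} _ | inj₁ (s≤s k≤n) = begin
  small k (map suc (upTo (suc n)))               ≡⟨ cong (small k) (identity-∷ʳ n) ⟩
  small k (map suc (upTo n) ∷ʳ suc n)            ≡⟨ small-++ k (map suc (upTo n)) [ suc n ] ⟩
  small k (map suc (upTo n)) ++ small k [ suc n ] ≡⟨ cong₂ _++_ (small-identity k≤n) (filter-reject (_≤? k) (<⇒≱ (s≤s k≤n))) ⟩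
  map suc (upTo k) ++ []                         ≡⟨ ++-identityʳ _ ⟩
  map suc (upTo k)                               ∎
  where open ≡-Reasoning

small-perm : ∀ {k n x} → k ≤ n → IsPermutation n x → IsPermutation k (small k x)
small-perm {k} k≤n π = ↭-trans (filter-↭ (_≤? k) π) (↭-reflexive (small-identity k≤n))

small-avoids : ∀ {x y} k → Avoids x y → Avoids (small k x) y
small-avoids {x} {y} k = avoids-⊆ {y = y} (filter-⊆ (_≤? k) x)

filter-filter : ∀ {P Q : Pred ℕ 0ℓ} (P? : Decidable P) (Q? : Decidable Q) → (∀ {a} → P a → Q a) →
  ∀ x → filter P? (filter Q? x) ≡ filter P? x
filter-filter P? Q? P⇒Q [] = refl
filter-filter P? Q? P⇒Q (a ∷ x) with Q? a
... | no ¬qa = trans (filter-filter P? Q? P⇒Q x) (sym (filter-reject P? (¬qa ∘ P⇒Q)))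
... | yes _ with P? a
...   | yes _ = cong (a ∷_) (filter-filter P? Q? P⇒Q x)
...   | no _ = filter-filter P? Q? P⇒Q x

small-small : ∀ {j k} x → j ≤ k → small j (small k x) ≡ small j x
small-small {j} {k} x j≤k = filter-filter (_≤? j) (_≤? k) (λ a≤j → ≤-trans a≤j j≤k) x

small-drop-max : ∀ {k} p q → IsPermutation (suc k) (p ++ suc k ∷ q) → small k (p ++ suc k ∷ q) ≡ p ++ q
small-drop-max {k} p q π = begin
  small k (p ++ suc k ∷ q)          ≡⟨ small-++ k p (suc k ∷ q) ⟩
  small k p ++ small k (suc k ∷ q)  ≡⟨ cong (small k p ++_) (filter-reject (_≤? k) 1+n≰n) ⟩
  small k p ++ small k q            ≡⟨ small-++ k p q ⟨
  small k (p ++ q)                  ≡⟨ filter-all (_≤? k) (perm-≤ (perm-drop-max p q π)) ⟩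
  p ++ q                            ∎
  where open ≡-Reasoning

-- A stall in the count means that the two largest entries are adjacent.

cuts-perm : ∀ {k} p q → IsPermutation (suc k) (p ++ suc k ∷ q) →
  cuts [] (p ++ suc k ∷ q) ≡ suc (cuts p q)
cuts-perm p q π = cuts-insert-max p q (All.map s≤s (All.++⁻ˡ p bound)) (All.map m≤n⇒m≤1+n (All.++⁻ʳ p bound))
  where bound = perm-≤ (perm-drop-max p q π)

-- The site just after the maximum of a 132-avoider is a cut; lying strictly inside p
-- it would make the word lose a cut when the next maximum is inserted after p.
stall⇒adjacent : ∀ {j} p q → IsPermutation (2 + j) (p ++ 2 + j ∷ q) → Avoids (p ++ 2 + j ∷ q) pattern132 →
  cuts [] (p ++ 2 + j ∷ q) ≡ cuts [] (p ++ q) → cuts [] (p ++ q) ≤ cuts [] (small j (p ++ q)) →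
  ∃[ b ] ∃[ r ] p ≡ b ∷ r ∷ʳ suc j
stall⇒adjacent [] q π av eq _ = contradiction (trans (sym (cuts-perm [] q π)) eq) 1+n≢n
stall⇒adjacent {j} (b ∷ p) q π av eq le with ∈-++⁻ (b ∷ p) (perm-max∈ (perm-drop-max (b ∷ p) q π))
-- If `suc j` came after `2 + j`, then `b`, `2 + j`, `suc j` would be an occurrence of 132.
... | inj₂ m∈q with ∈-∃++ m∈q
...   | q₁ , q₂ , refl = contradiction (n<1+n _)
        (avoids-132 av (++⁺ (refl ∷ []) (++⁺ˡ p (refl ∷ from∈ m∈q))) (s≤s b≤j))
  where
  -- Removing both `2 + j` and `suc j` leaves a permutation of size `j` that still begins with `b`.
  b≤j : b ≤ j
  b≤j = All.head (perm-≤ (perm-drop-max (b ∷ p ++ q₁) q₂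
    (subst (IsPermutation (suc j)) (sym (++-assoc (b ∷ p) q₁ (suc j ∷ q₂))) (perm-drop-max (b ∷ p) q π))))
stall⇒adjacent {j} (b ∷ p) q π av eq le | inj₁ m∈p with ∈-∃++ m∈p
-- If `suc j` came first, its insertion would already have raised the count by one, against `le`.
... | [] , s , refl = contradiction le (<⇒≱ (≤-reflexive (sym (begin
    cuts [] (suc j ∷ s ++ q)                ≡⟨ cuts-perm [] (s ++ q) π′ ⟩
    suc (cuts [] (s ++ q))                  ≡⟨ cong (suc ∘ cuts []) (small-drop-max [] (s ++ q) π′) ⟨
    suc (cuts [] (small j (suc j ∷ s ++ q))) ∎))))
  where
  open ≡-Reasoning
  π′ = perm-drop-max (suc j ∷ s) q π
... | b ∷ r , [] , refl = b , r , refl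
... | b ∷ r , c ∷ s , refl = contradiction (begin-strict
    cuts [] (p′ ++ 2 + j ∷ q)                       ≡⟨ cuts-perm p′ q π ⟩
    suc (cuts p′ q)                                 <⟨ n<1+n _ ⟩
    -- The `2` stands for the leftmost site and the site just after `suc j`, both before the end of
    -- `p′`.
    2 + cuts p′ q                                   ≡⟨ cong (λ z → 2 + cuts z q) p′-split ⟩
    2 + cuts (((b ∷ r ∷ʳ suc j) ∷ʳ c) ++ s) q       ≤⟨ s≤s (s≤s (cuts-++-≤ ((b ∷ r ∷ʳ suc j) ∷ʳ c) s q)) ⟩
    2 + cuts ((b ∷ r ∷ʳ suc j) ∷ʳ c) (s ++ q)       ≡⟨ cong suc (cuts-yes cut) ⟨
    1 + cuts (b ∷ r ∷ʳ suc j) (c ∷ s ++ q)          ≤⟨ s≤s (cuts-++-≤ [ b ] (r ∷ʳ suc j) (c ∷ s ++ q)) ⟩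
    1 + cuts [ b ] ((r ∷ʳ suc j) ++ c ∷ s ++ q)     ≡⟨ cong (suc ∘ cuts [ b ]) (trans (∷ʳ-++ r (suc j) (c ∷ s ++ q)) (sym (++-assoc r (suc j ∷ c ∷ s) q))) ⟩
    cuts [] (p′ ++ q)                               ∎) (<-irrefl eq)
  where
  open ≤-Reasoning
  p′ : Word
  p′ = b ∷ r ++ suc j ∷ c ∷ s
  p′-split : p′ ≡ ((b ∷ r ∷ʳ suc j) ∷ʳ c) ++ s
  p′-split = sym (trans (∷ʳ-++ (b ∷ r ∷ʳ suc j) c s) (∷ʳ-++ (b ∷ r) (suc j) (c ∷ s)))
  split : p′ ++ q ≡ (b ∷ r) ++ suc j ∷ (c ∷ s ++ q)
  split = ++-assoc (b ∷ r) (suc j ∷ c ∷ s) q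
  bound : All (_≤ j) ((b ∷ r) ++ (c ∷ s ++ q))
  bound = perm-≤ (perm-drop-max (b ∷ r) (c ∷ s ++ q) (subst (IsPermutation (suc j)) split (perm-drop-max p′ q π)))
  av′ : Avoids ((b ∷ r) ++ suc j ∷ (c ∷ s ++ q)) pattern132
  av′ = subst (λ z → Avoids z pattern132) split (avoids-⊆ (++⁺ (⊆-refl {x = p′}) (2 + j skip ⊆-refl)) av)
  -- The entries before `suc j` dominate the right side by avoidance; `suc j` does so by size.
  cut : Cut (b ∷ r ∷ʳ suc j) (c ∷ s ++ q)
  cut = All.++⁺
    (Equivalence.to (insertMax-avoids⇔cut (b ∷ r) (avoids-⊆ (++⁺ (⊆-refl {x = b ∷ r}) (suc j skip ⊆-refl)) av′) (All.map s≤s bound)) av′)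
    (All.map m≤n⇒m≤1+n (All.++⁻ʳ (b ∷ r) bound) ∷ [])

-- Since `b < suc j`, no site between `b` and `suc j` is a cut, so with or without `2 + j` the count
-- is the leftmost site plus the cuts from the end of `p`. Deleting `suc j` as well loses no cut,
-- and may free sites inside `b ∷ r`.
adjacent⇒stall : ∀ {j} b r q → let p = b ∷ r ∷ʳ suc j in IsPermutation (2 + j) (p ++ 2 + j ∷ q) →
  cuts [] (p ++ 2 + j ∷ q) ≡ cuts [] (p ++ q) × cuts [] (p ++ q) ≤ cuts [] (small j (p ++ q))
adjacent⇒stall {j} b r q π = eq , le
  where
  p : Word
  p = b ∷ r ∷ʳ suc j
  split : p ++ q ≡ b ∷ r ++ suc j ∷ q
  split = ∷ʳ-++ (b ∷ r) (suc j) q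
  π′ : IsPermutation (suc j) (b ∷ r ++ suc j ∷ q)
  π′ = subst (IsPermutation (suc j)) split (perm-drop-max p q π)
  b≤j : b ≤ j
  b≤j = All.head (perm-≤ (perm-drop-max (b ∷ r) q π′))
  eq : cuts [] (p ++ 2 + j ∷ q) ≡ cuts [] (p ++ q)
  eq = begin
    cuts [] (p ++ 2 + j ∷ q)         ≡⟨ cuts-perm p q π ⟩
    suc (cuts (b ∷ r ∷ʳ suc j) q)    ≡⟨ cong suc (cuts-skip [ b ] r q (here refl) (s≤s b≤j)) ⟨
    cuts [] (b ∷ r ++ suc j ∷ q)     ≡⟨ cong (cuts []) split ⟨
    cuts [] (p ++ q)                 ∎
    where open ≡-Reasoning
  le : cuts [] (p ++ q) ≤ cuts [] (small j (p ++ q))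
  le = begin
    cuts [] (p ++ q)                       ≡⟨ cong (cuts []) split ⟩
    cuts [] (b ∷ r ++ suc j ∷ q)           ≡⟨ cuts-perm (b ∷ r) q π′ ⟩
    suc (cuts (b ∷ r) q)                   ≤⟨ s≤s (cuts-++-≤ [ b ] r q) ⟩
    cuts [] (b ∷ r ++ q)                   ≡⟨ cong (cuts []) (small-drop-max (b ∷ r) q π′) ⟨
    cuts [] (small j (b ∷ r ++ suc j ∷ q)) ≡⟨ cong (cuts [] ∘ small j) split ⟨
    cuts [] (small j (p ++ q))             ∎
    where open ≤-Reasoning

sites : ℕ → Word → ℕ
sites k x = ∣ activeSites (small k x) pattern132 ∣

-- The condition of the theorem at `i = n - 1 - j`, indexed by the sizes of the restrictions.
Stall : ℕ → Word → Set
Stall j x = sites (2 + j) x ≡ sites (1 + j) x × sites (1 + j) x ≤ sites j x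

sites≡cuts : ∀ {k n x} → k ≤ n → IsPermutation n x → Avoids x pattern132 →
  sites k x ≡ cuts [] (small k x)
sites≡cuts {k} {n} {x} k≤n π av = ∣activeSites∣≡cuts (small k x) (small-avoids k av)
  (subst (λ z → All (_≤ z) (small k x)) (sym (perm-length σ)) (perm-≤ σ))
  where σ = small-perm k≤n π

stall⇔adjacent : ∀ {j n x} → 2 + j ≤ n → IsPermutation n x → Avoids x pattern132 →
  Stall j x ⇔ (∃[ b ] ∃[ r ] ∃[ q ] small (2 + j) x ≡ b ∷ r ++ suc j ∷ 2 + j ∷ q)
stall⇔adjacent {j} {n} {x} k≤n π av = mk⇔ to from
  where
  σ : IsPermutation (2 + j) (small (2 + j) x)
  σ = small-perm k≤n π
  1+j≤n : 1 + j ≤ n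
  1+j≤n = ≤-trans (n≤1+n _) k≤n
  level₁ : ∀ p q → small (2 + j) x ≡ p ++ 2 + j ∷ q → small (1 + j) x ≡ p ++ q
  level₁ p q e = begin
    small (1 + j) x                    ≡⟨ small-small x (n≤1+n _) ⟨
    small (1 + j) (small (2 + j) x)    ≡⟨ cong (small (1 + j)) e ⟩
    small (1 + j) (p ++ 2 + j ∷ q)     ≡⟨ small-drop-max p q (subst (IsPermutation (2 + j)) e σ) ⟩
    p ++ q                             ∎
    where open ≡-Reasoning
  sites₂ : ∀ p q → small (2 + j) x ≡ p ++ 2 + j ∷ q → sites (2 + j) x ≡ cuts [] (p ++ 2 + j ∷ q)
  sites₂ p q e = trans (sites≡cuts k≤n π av) (cong (cuts []) e)
  sites₁ : ∀ p q → small (2 + j) x ≡ p ++ 2 + j ∷ q → sites (1 + j) x ≡ cuts [] (p ++ q)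
  sites₁ p q e = trans (sites≡cuts 1+j≤n π av) (cong (cuts []) (level₁ p q e))
  sites₀ : ∀ p q → small (2 + j) x ≡ p ++ 2 + j ∷ q → sites j x ≡ cuts [] (small j (p ++ q))
  sites₀ p q e = trans (sites≡cuts (≤-trans (n≤1+n _) 1+j≤n) π av)
    (cong (cuts []) (trans (sym (small-small x (n≤1+n j))) (cong (small j) (level₁ p q e))))
  to : Stall j x → ∃[ b ] ∃[ r ] ∃[ q ] small (2 + j) x ≡ b ∷ r ++ suc j ∷ 2 + j ∷ q
  to (eq , le) with ∈-∃++ (perm-max∈ σ)
  ... | p , q , e with stall⇒adjacent p q (subst (IsPermutation (2 + j)) e σ)
                         (subst (λ z → Avoids z pattern132) e (small-avoids (2 + j) av))
                         (trans (sym (sites₂ p q e)) (trans eq (sites₁ p q e)))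
                         (≤-trans (≤-reflexive (sym (sites₁ p q e))) (≤-trans le (≤-reflexive (sites₀ p q e))))
  ...   | b , r , refl = b , r , q , trans e (∷ʳ-++ (b ∷ r) (suc j) (2 + j ∷ q))
  from : ∃[ b ] ∃[ r ] ∃[ q ] small (2 + j) x ≡ b ∷ r ++ suc j ∷ 2 + j ∷ q → Stall j x
  from (b , r , q , e) = trans (sites₂ p q e′) (trans (proj₁ st) (sym (sites₁ p q e′))) ,
    ≤-trans (≤-reflexive (sites₁ p q e′)) (≤-trans (proj₂ st) (≤-reflexive (sym (sites₀ p q e′))))
    where
    p : Word
    p = b ∷ r ∷ʳ suc j
    e′ : small (2 + j) x ≡ p ++ 2 + j ∷ q
    e′ = trans e (sym (∷ʳ-++ (b ∷ r) (suc j) (2 + j ∷ q)))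
    st = adjacent⇒stall b r q (subst (IsPermutation (2 + j)) e′ σ)

-- Transfer of adjacency between a restriction and the whole word.

filter-++∷⁻ : ∀ {P : Pred ℕ 0ℓ} (P? : Decidable P) x p {z q} → filter P? x ≡ p ++ z ∷ q →
  ∃[ x₁ ] ∃[ x₂ ] (x ≡ x₁ ++ z ∷ x₂ × filter P? x₁ ≡ p × filter P? x₂ ≡ q)
filter-++∷⁻ P? [] [] ()
filter-++∷⁻ P? [] (_ ∷ _) ()
filter-++∷⁻ P? (a ∷ x) p e with P? a
filter-++∷⁻ P? (a ∷ x) p e | no ¬pa with filter-++∷⁻ P? x p e
... | x₁ , x₂ , refl , e₁ , e₂ = a ∷ x₁ , x₂ , refl , trans (filter-reject P? ¬pa) e₁ , e₂
filter-++∷⁻ P? (a ∷ x) [] refl | yes _ = [] , x , refl , refl , refl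
filter-++∷⁻ P? (a ∷ x) (b ∷ p) e | yes pa with ∷-injective e
... | refl , e′ with filter-++∷⁻ P? x p e′
... | x₁ , x₂ , refl , e₁ , e₂ = a ∷ x₁ , x₂ , refl , trans (filter-accept P? pa) (cong (a ∷_) e₁) , e₂

-- An occurrence of the bivincular pattern by list factors instead of indices; `y` is its middle
-- value.
Splits123⋆ : ℕ → Word → Set
Splits123⋆ y x = ∃[ x₁ ] ∃[ x₂ ] ∃[ a ] (x ≡ x₁ ++ y ∷ suc y ∷ x₂ × a ∈ x₁ × a < y)

adjacent-indices : ∀ (x₁ : Word) y z x₂ → let x = x₁ ++ y ∷ z ∷ x₂ in
  ∃[ b ] ∃[ c ] (toℕ c ≡ suc (toℕ b) × lookup x b ≡ y × lookup x c ≡ z)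
adjacent-indices [] y z x₂ = zero , suc zero , refl , refl , refl
adjacent-indices (_ ∷ x₁) y z x₂ with adjacent-indices x₁ y z x₂
... | b , c , e , eb , ec = suc b , suc c , cong suc e , eb , ec

splits⇒contains : ∀ {y x} → Splits123⋆ y x → Contains123⋆ x
splits⇒contains {y} (x₁ , x₂ , a , refl , a∈ , a<y) = go x₁ a∈
  where
  go : ∀ x₁ → a ∈ x₁ → Contains123⋆ (x₁ ++ y ∷ suc y ∷ x₂)
  go (_ ∷ x₁) (here refl) with adjacent-indices x₁ y (suc y) x₂
  ... | b , c , e , eb , ec = zero , suc b , suc c , z<s , cong suc e ,
    <-≤-trans a<y (≤-reflexive (sym eb)) , trans ec (cong suc (sym eb))
  go (_ ∷ x₁) (there a∈) with go x₁ a∈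
  ... | i , b , c , i<b , e , l , s = suc i , suc b , suc c , s<s i<b , cong suc e , l , s

adjacent-split : ∀ (x : Word) (a b c : Fin (length x)) → a Fin.< b → toℕ c ≡ suc (toℕ b) →
  ∃[ x₁ ] ∃[ x₂ ] (x ≡ x₁ ++ lookup x b ∷ lookup x c ∷ x₂ × lookup x a ∈ x₁)
adjacent-split (_ ∷ _ ∷ []) zero (suc zero) (suc zero) _ ()
adjacent-split (h ∷ _ ∷ _ ∷ _) zero (suc zero) (suc (suc zero)) _ _ = [ h ] , _ , refl , here refl
-- The recursive call gets index `zero` of the tail as a dummy first index. Only its factorisation
-- is kept; the wanted smaller entry is `h`.
adjacent-split (h ∷ x@(_ ∷ _)) zero (suc (suc b)) (suc c) _ e
  with adjacent-split x zero (suc b) c z<s (suc-injective e)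
... | x₁ , x₂ , eq , _ = h ∷ x₁ , x₂ , cong (h ∷_) eq , here refl
adjacent-split (h ∷ x) (suc a) (suc b) (suc c) (s<s a<b) e
  with adjacent-split x a b c a<b (suc-injective e)
... | x₁ , x₂ , eq , a∈ = h ∷ x₁ , x₂ , cong (h ∷_) eq , there a∈

contains⇒splits : ∀ {x} → Contains123⋆ x → ∃[ y ] Splits123⋆ y x
contains⇒splits {x} (a , b , c , a<b , e , l , s) with adjacent-split x a b c a<b e
... | x₁ , x₂ , eq , a∈ = lookup x b , x₁ , x₂ , lookup x a ,
  trans eq (cong (λ z → x₁ ++ lookup x b ∷ z ∷ x₂) s) , a∈ , l

adjacent⇒splits : ∀ {j n x b r q} → 2 + j ≤ n → IsPermutation n x → Avoids x pattern132 →
  small (2 + j) x ≡ b ∷ r ++ suc j ∷ 2 + j ∷ q → Splits123⋆ (suc j) x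
adjacent⇒splits {j} {n} {x} {b} {r} {q} k≤n π av e with filter-++∷⁻ (_≤? 2 + j) x (b ∷ r) e
... | x₁ , x₂ , refl , e₁ , e₂ with filter-++∷⁻ (_≤? 2 + j) x₂ [] e₂
... | [] , x₄ , refl , e₃ , e₄ = x₁ , x₄ , b , refl ,
  proj₁ (∈-filter⁻ (_≤? 2 + j) (subst (b ∈_) (sym e₁) (here refl))) , s≤s b≤j
  where
  e′ = trans e (sym (∷ʳ-++ (b ∷ r) (suc j) (2 + j ∷ q)))
  π₂ = perm-drop-max (b ∷ r ∷ʳ suc j) q (subst (IsPermutation (2 + j)) e′ (small-perm k≤n π))
  b≤j : b ≤ j
  b≤j = All.head (perm-≤ (perm-drop-max (b ∷ r) q (subst (IsPermutation (suc j)) (∷ʳ-++ (b ∷ r) (suc j) q) π₂)))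
-- An entry `z` between `suc j` and `2 + j` was filtered out, so it is larger than both and
-- completes a 132.
... | z ∷ x₃ , x₄ , refl , e₃ , e₄ = contradiction (≰⇒> z≰k)
  (avoids-132 av (++⁺ˡ x₁ (refl ∷ refl ∷ ++⁺ˡ x₃ (refl ∷ minimum x₄))) (n<1+n _))
  where
  z≰k : ¬ z ≤ 2 + j
  z≰k z≤k = case trans (sym (filter-accept (_≤? 2 + j) z≤k)) e₃ of λ ()

-- The entry `a` is small enough to survive the filter, so something still precedes `suc j` in the
-- restriction.
splits⇒adjacent : ∀ {j x} → Splits123⋆ (suc j) x →
  ∃[ b ] ∃[ r ] ∃[ q ] small (2 + j) x ≡ b ∷ r ++ suc j ∷ 2 + j ∷ q
splits⇒adjacent {j} {x} (x₁ , x₂ , a , refl , a∈ , a<y) = nonempty (small k x₁) refl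
  where
  k = 2 + j
  e : small k x ≡ small k x₁ ++ suc j ∷ 2 + j ∷ small k x₂
  e = trans (small-++ k x₁ (suc j ∷ k ∷ x₂)) (cong (small k x₁ ++_)
        (trans (filter-accept (_≤? k) (n≤1+n _)) (cong (suc j ∷_) (filter-accept (_≤? k) ≤-refl))))
  nonempty : ∀ p → small k x₁ ≡ p → ∃[ b ] ∃[ r ] ∃[ q ] small k x ≡ b ∷ r ++ suc j ∷ k ∷ q
  nonempty [] e₁ = case subst (a ∈_) e₁ (∈-filter⁺ (_≤? k) a∈ (m≤n⇒m≤1+n (<⇒≤ a<y))) of λ ()
  nonempty (b ∷ r) e₁ = b , r , small k x₂ , trans e (cong (_++ suc j ∷ k ∷ small k x₂) e₁)

-- From `0 < a < y` comes `2 ≤ y`, which will give `i ≤ n ∸ 2`; from `suc y ≤ n` will come `1 ≤ i`.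
splits-bounds : ∀ {y n x} → IsPermutation n x → Splits123⋆ y x → ∃[ j ] (y ≡ 2 + j × 3 + j ≤ n)
splits-bounds {zero} π (_ , _ , _ , _ , _ , ())
splits-bounds {suc zero} π (x₁ , x₂ , a , refl , a∈ , s≤s a≤0) =
  contradiction (perm-positive π (∈-++⁺ˡ a∈)) (≤⇒≯ a≤0)
splits-bounds {suc (suc j)} π (x₁ , x₂ , a , refl , a∈ , _) =
  j , refl , All.lookup (perm-≤ π) (∈-++⁺ʳ x₁ (there (here refl)))

-- Matching the indices of `Act` with restriction sizes.

-- For `n = i + (2 + j)`, this is the size `n + 1 - (i + c)` of the restriction behind
-- `Act (i + c)`.
level : ∀ i j c d → c + d ≡ 3 + j → suc (i + (2 + j)) ∸ (i + c) ≡ d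
level i j c d e = begin
  suc (i + (2 + j)) ∸ (i + c)  ≡⟨ cong (_∸ (i + c)) (+-suc i (2 + j)) ⟨
  i + (3 + j) ∸ (i + c)        ≡⟨ cong (λ z → i + z ∸ (i + c)) e ⟨
  i + (c + d) ∸ (i + c)        ≡⟨ cong (_∸ (i + c)) (+-assoc i c d) ⟨
  i + c + d ∸ (i + c)          ≡⟨ m+n∸m≡n (i + c) d ⟩
  d                            ∎
  where open ≡-Reasoning

theorem3p17 : ∀ (n : ℕ) → 3 ≤ n → (x : Word) → IsPermutation n x → Avoids x pattern132 →
    (∃[ i ] (1 ≤ i × i ≤ n ∸ 2 ×
    ∣ Act i x pattern132 ∣ ≡ ∣ Act (i + 1) x pattern132 ∣ ×
    ∣ Act (i + 1) x pattern132 ∣ ≤ ∣ Act (i + 2) x pattern132 ∣))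
    ⇔ Contains123⋆ x
theorem3p17 n 3≤n x π av = mk⇔ to from
  where
  LHS : Set
  LHS = ∃[ i ] (1 ≤ i × i ≤ n ∸ 2 ×
    ∣ Act i x pattern132 ∣ ≡ ∣ Act (i + 1) x pattern132 ∣ ×
    ∣ Act (i + 1) x pattern132 ∣ ≤ ∣ Act (i + 2) x pattern132 ∣)

  act : ∀ i {j} c d → i + (2 + j) ≡ n → c + d ≡ 3 + j → ∣ Act (i + c) x pattern132 ∣ ≡ sites d x
  act i {j} c d en e = cong (λ k → sites k x)
    (trans (cong (λ z → suc z ∸ (i + c)) (trans (perm-length π) (sym en))) (level i j c d e))

  act₀ : ∀ i {j} → i + (2 + j) ≡ n → ∣ Act i x pattern132 ∣ ≡ sites (3 + j) x
  act₀ i {j} en = trans (cong (λ k → ∣ Act k x pattern132 ∣) (sym (+-identityʳ i))) (act i 0 (3 + j) en refl)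

  to : LHS → Contains123⋆ x
  -- Here `j = n - 2 - i`, so the largest of the three restrictions has size `3 + j`.
  to (i , 1≤i , i≤n∸2 , eq , le) with m≤n⇒∃[o]m+o≡n i≤n∸2
  ... | j , ej = case Equivalence.to (stall⇔adjacent 3+j≤n π av) stall of λ
      { (b , r , q , e) → splits⇒contains (adjacent⇒splits 3+j≤n π av e) }
    where
    open ≡-Reasoning
    en : i + (2 + j) ≡ n
    en = begin
      i + (2 + j)    ≡⟨ cong (i +_) (+-comm 2 j) ⟩
      i + (j + 2)    ≡⟨ +-assoc i j 2 ⟨
      i + j + 2      ≡⟨ cong (_+ 2) ej ⟩
      n ∸ 2 + 2      ≡⟨ m∸n+n≡m (≤-trans (n≤1+n 2) 3≤n) ⟩
      n              ∎
    3+j≤n : 3 + j ≤ n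
    3+j≤n = ≤-trans (+-monoˡ-≤ (2 + j) 1≤i) (≤-reflexive en)
    stall : Stall (1 + j) x
    stall = trans (sym (act₀ i en)) (trans eq (act i 1 (2 + j) en refl)) ,
      ≤-trans (≤-reflexive (sym (act i 1 (2 + j) en refl))) (≤-trans le (≤-reflexive (act i 2 (1 + j) en refl)))

  from : Contains123⋆ x → LHS
  from con with contains⇒splits con
  ... | y , sp with splits-bounds π sp
  ... | j , refl , 3+j≤n with m≤n⇒∃[o]m+o≡n 3+j≤n
  -- The middle value is `2 + j`, so the top restriction must have size `3 + j`; as `n = 3 + j + o`,
  -- this forces `i = suc o`.
  ... | o , eo = suc o , s≤s z≤n , i≤n∸2 ,
      trans (act₀ (suc o) en) (trans (proj₁ stall) (sym (act (suc o) 1 (2 + j) en refl))) ,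
      ≤-trans (≤-reflexive (act (suc o) 1 (2 + j) en refl)) (≤-trans (proj₂ stall) (≤-reflexive (sym (act (suc o) 2 (1 + j) en refl))))
    where
    stall : Stall (1 + j) x
    stall = Equivalence.from (stall⇔adjacent 3+j≤n π av) (splits⇒adjacent sp)
    en : suc o + (2 + j) ≡ n
    en = trans (cong suc (+-comm o (2 + j))) eo
    i≤n∸2 : suc o ≤ n ∸ 2
    i≤n∸2 = ≤-trans (m≤n+m (suc o) j) (≤-reflexive (trans (+-suc j o) (cong (_∸ 2) eo)))
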